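{- Let $G$ be a graph with maximum degree $\Delta(G)$. Then \[\overset{\rightarrow}{\Gamma}_{LD}(G)\geq\frac{\gamma_{LD}(G)}{\lceil\log_2\Delta(G)\rceil+1}.\]
   Context: For an undirected graph $G=(V,E)$, $S\subseteq V$ is a locating-dominating set if every $u\notin S$ has $N(u)\cap S\neq\emptyset$ and distinct $u,v\notin S$ satisfy $N(u)\cap S\neq N(v)\cap S$; $\gamma_{LD}(G)$ is the minimum size. For an orientation $D$ of $G$ (each edge given exactly one direction), $S$ is locating-dominating in $D$ if the same holds with $N(\cdot)$ replaced by the in-neighbourhood $N^-_D(\cdot)$; $\gamma_{LD}(D)$ is the minimum size. The upper directed location-domination number is $\overset{\rightarrow}{\Gamma}_{LD}(G)=\max_D\gamma_{LD}(D)$ over all orientations $D$ of $G$. -}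

module Defs where

open import Data.Nat using (ℕ; _≤_; _⊔_)
open import Data.Bool using (Bool; true; false)
open import Data.Fin using (Fin)
open import Data.Fin.Subset using (Subset; _∈_; _∉_; ∣_∣)
open import Data.Vec using (tabulate; foldr; allFin; map)
open import Data.Product using (Σ; _×_; ∃)
open import Data.Sum using (_⊎_)
open import Relation.Nullary using (¬_)
open import Relation.Binary.PropositionalEquality using (_≡_)

record Graph (n : ℕ) : Set where
  field
    adj   : Fin n → Fin n → Bool
    sym   : ∀ u v → adj u v ≡ adj v u
    irrefl : ∀ u → adj u u ≡ false
open Graph public

-- degree of u and maximum degree Δ(G) (Δ = 0 when n = 0)
degree : ∀ {n} → Graph n → Fin n → ℕ
degree G u = ∣ tabulate (adj G u) ∣

maxDegree : ∀ {n} → Graph n → ℕ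
maxDegree {n} G = foldr (λ _ → ℕ) _⊔_ 0 (map (degree G) (allFin n))

-- An orientation of G: arc u v = true means the edge uv is directed u → v.
-- Every edge gets exactly one direction, and arcs only on edges.
record Orientation {n : ℕ} (G : Graph n) : Set where
  field
    arc      : Fin n → Fin n → Bool
    arc⇒adj  : ∀ u v → arc u v ≡ true → adj G u v ≡ true
    adj⇒one  : ∀ u v → adj G u v ≡ true →
               (arc u v ≡ true × arc v u ≡ false) ⊎ (arc u v ≡ false × arc v u ≡ true)
open Orientation public

-- Generic locating-domination w.r.t. a neighbourhood function:
-- N u v ≡ true means v ∈ N(u).
IsLocDom : ∀ {n} → (Fin n → Fin n → Bool) → Subset n → Set
IsLocDom {n} N S =
  (∀ u → u ∉ S → ∃ λ v → v ∈ S × N u v ≡ true)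
  × (∀ u w → u ∉ S → w ∉ S → ¬ (u ≡ w) →
       ¬ (∀ v → v ∈ S → N u v ≡ N w v))

nbhd : ∀ {n} → Graph n → Fin n → Fin n → Bool
nbhd G u v = adj G u v

inNbhd : ∀ {n} {G : Graph n} → Orientation G → Fin n → Fin n → Bool
inNbhd D u v = arc D v u

IsMinLD : ∀ {n} → (Fin n → Fin n → Bool) → ℕ → Set
IsMinLD N k = (∃ λ S → IsLocDom N S × ∣ S ∣ ≡ k)
            × (∀ S → IsLocDom N S → k ≤ ∣ S ∣)

IsγLD : ∀ {n} → Graph n → ℕ → Set
IsγLD G k = IsMinLD (nbhd G) k

IsγLDᴰ : ∀ {n} {G : Graph n} → Orientation G → ℕ → Set
IsγLDᴰ D k = IsMinLD (inNbhd D) k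

IsUpperDirLD : ∀ {n} → Graph n → ℕ → Set
IsUpperDirLD G m =
  (∃ λ (D : Orientation G) → IsγLDᴰ D m)
  × (∀ (D : Orientation G) k → IsγLDᴰ D k → k ≤ m)

{-# OPTIONS --safe #-}

-- An optimal locating-dominating set S₀ of any orientation dominates G, so the
-- vertices outside S₀ with a common trace N(u) ∩ S₀ form classes of size at
-- most Δ(G).  Given S, orient G along a linear order in which every class is an
-- interval, and let S′ be an optimal locating-dominating set of that
-- orientation.  If u < v lie in one class of S and also in one class of S ∪ S′,
-- their in-neighbourhoods differ in S′, which forces an element of S′ between
-- them in the order, hence in the same class of S.  Thus a class of size m only
-- leaves classes of size at most ⌈m/2⌉, and after ⌈log₂ Δ(G)⌉ further sets,
-- each of size at most Γ, all classes are singletons.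
module Submission where

open import Defs
open import Data.Bool using (Bool; true; false; _∧_)
import Data.Bool.Properties as Bool
open import Data.Fin using (Fin; zero; suc; toℕ; combine; _<_; _≟_; _<?_)
import Data.Fin.Properties as Fin
open import Data.Fin.Subset using (Subset; inside; outside; _∈_; _∉_; _⊆_; _∪_; ∣_∣; ⊤)
open import Data.Fin.Subset.Properties
  using (_∈?_; ∈⊤; anySubset?; drop-there; drop-∷-⊆; p⊆q⇒∣p∣≤∣q∣; p⊆p∪q; q⊆p∪q; x∈p⇒∣p-x∣<∣p∣;
         x∈p∧x≢y⇒x∈p-y)
open import Data.Nat using (ℕ; zero; suc; _≤_; _*_; _+_; _^_; _⊔_; ⌈_/2⌉; z≤n; s≤s)
import Data.Nat as ℕ
open import Data.Nat.Induction using (Acc; acc; <-wellFounded)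
open import Data.Nat.Logarithm using (⌈log₂_⌉; ⌈log₂⌈n/2⌉⌉≡⌈log₂n⌉∸1)
import Data.Nat.Properties as ℕ
open import Data.Product using (∃; _×_; _,_; proj₁; proj₂)
open import Data.Sum using (inj₁; inj₂)
open import Data.Vec using (Vec; []; _∷_; lookup; tabulate; foldr; map; allFin; here; there)
open import Data.Vec.Properties
  using (lookup∘tabulate; lookup⇒[]=; []=⇒lookup; lookup-map; lookup-allFin; ≡-dec; ∷-injective; tabulate-cong)
open import Function using (_∘_)
open import Relation.Binary using (tri<; tri≈; tri>)
open import Relation.Binary.PropositionalEquality using (_≡_; _≢_; refl; trans; cong; cong₂; subst; module ≡-Reasoning)
import Relation.Binary.PropositionalEquality as ≡
open import Relation.Nullary using (Dec; yes; no; does; contradiction; ¬?; _×-dec_; _→-dec_)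
open import Relation.Nullary.Decidable using (dec-true; dec-false)

private
  variable
    n : ℕ

-- Finite subsets and their cardinalities.

does≡true⇒ : ∀ {A : Set} (a? : Dec A) → does a? ≡ true → A
does≡true⇒ (yes a) _ = a

∈-tabulate⁺ : ∀ {f : Fin n → Bool} {i} → f i ≡ true → i ∈ tabulate f
∈-tabulate⁺ {f = f} {i} fi = lookup⇒[]= i _ (trans (lookup∘tabulate f i) fi)

∈-tabulate⁻ : ∀ {f : Fin n → Bool} {i} → i ∈ tabulate f → f i ≡ true
∈-tabulate⁻ {f = f} {i} i∈ = trans (≡.sym (lookup∘tabulate f i)) ([]=⇒lookup i∈)

∉⇒lookup≡false : ∀ {p : Subset n} {i} → i ∉ p → lookup p i ≡ false
∉⇒lookup≡false {p = p} {i} i∉p = Bool.¬-not (i∉p ∘ lookup⇒[]= i p)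

∣p∪q∣≤∣p∣+∣q∣ : ∀ (p q : Subset n) → ∣ p ∪ q ∣ ≤ ∣ p ∣ + ∣ q ∣
∣p∪q∣≤∣p∣+∣q∣ []            []            = z≤n
∣p∪q∣≤∣p∣+∣q∣ (outside ∷ p) (outside ∷ q) = ∣p∪q∣≤∣p∣+∣q∣ p q
∣p∪q∣≤∣p∣+∣q∣ (outside ∷ p) (inside  ∷ q) rewrite ℕ.+-suc ∣ p ∣ ∣ q ∣ = s≤s (∣p∪q∣≤∣p∣+∣q∣ p q)
∣p∪q∣≤∣p∣+∣q∣ (inside  ∷ p) (outside ∷ q) = s≤s (∣p∪q∣≤∣p∣+∣q∣ p q)
∣p∪q∣≤∣p∣+∣q∣ (inside  ∷ p) (inside  ∷ q) rewrite ℕ.+-suc ∣ p ∣ ∣ q ∣ =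
  s≤s (ℕ.m≤n⇒m≤1+n (∣p∪q∣≤∣p∣+∣q∣ p q))

distinct∈⇒2≤∣p∣ : ∀ {p : Subset n} {i j} → i ∈ p → j ∈ p → i ≢ j → 2 ≤ ∣ p ∣
distinct∈⇒2≤∣p∣ i∈p j∈p i≢j =
  ℕ.≤-trans (s≤s (ℕ.≤-trans (s≤s z≤n) (x∈p⇒∣p-x∣<∣p∣ (x∈p∧x≢y⇒x∈p-y i∈p i≢j)))) (x∈p⇒∣p-x∣<∣p∣ j∈p)

-- Counting interleaved subsets.

Interleaved : Subset n → Subset n → Set
Interleaved p q = ∀ {i j} → i ∈ p → j ∈ p → i < j → ∃ λ k → k ∈ q × k ∉ p × i < k × k < j

Interleaved-tail : ∀ {s t} {p q : Subset n} → Interleaved (s ∷ p) (t ∷ q) → Interleaved p q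
Interleaved-tail sep i∈p j∈p i<j with sep (there i∈p) (there j∈p) (s≤s i<j)
... | suc k , k∈q , k∉p , s≤s i<k , s≤s k<j = k , drop-there k∈q , k∉p ∘ there , i<k , k<j

mutual
  -- Each gap between consecutive elements of `p` holds an element of `q` outside `p`, so a nonempty
  -- `p` leaves room in `q` for `∣ p ∣ - 1` further elements. Once the first element of `p` is
  -- passed, all later ones are preceded by such an element.
  interleaved⇒∣p∣+∣p∣≤1+∣q∣ : ∀ {p q : Subset n} → p ⊆ q → Interleaved p q → ∣ p ∣ + ∣ p ∣ ≤ suc ∣ q ∣
  interleaved⇒∣p∣+∣p∣≤1+∣q∣ {p = []} {[]} _ _ = z≤n
  interleaved⇒∣p∣+∣p∣≤1+∣q∣ {p = outside ∷ p} {outside ∷ q} p⊆q sep =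
    interleaved⇒∣p∣+∣p∣≤1+∣q∣ (drop-∷-⊆ p⊆q) (Interleaved-tail sep)
  interleaved⇒∣p∣+∣p∣≤1+∣q∣ {p = outside ∷ p} {inside ∷ q} p⊆q sep =
    ℕ.m≤n⇒m≤1+n (interleaved⇒∣p∣+∣p∣≤1+∣q∣ (drop-∷-⊆ p⊆q) (Interleaved-tail sep))
  interleaved⇒∣p∣+∣p∣≤1+∣q∣ {p = inside ∷ p} {outside ∷ q} p⊆q sep with () ← p⊆q here
  interleaved⇒∣p∣+∣p∣≤1+∣q∣ {p = inside ∷ p} {inside ∷ q} p⊆q sep rewrite ℕ.+-suc ∣ p ∣ ∣ p ∣ =
    s≤s (s≤s (preceded⇒∣p∣+∣p∣≤∣q∣ (drop-∷-⊆ p⊆q) (Interleaved-tail sep) preceded))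
    where
    preceded : ∀ {j} → j ∈ p → ∃ λ k → k ∈ q × k ∉ p × k < j
    preceded j∈p with sep here (there j∈p) (s≤s z≤n)
    ... | suc k , k∈q , k∉p , _ , s≤s k<j = k , drop-there k∈q , k∉p ∘ there , k<j

  -- The state after an element of `p` has been passed: one more element of `q` outside `p` lies
  -- ahead of the first remaining element of `p`, which improves the bound by one.
  preceded⇒∣p∣+∣p∣≤∣q∣ : ∀ {p q : Subset n} → p ⊆ q → Interleaved p q →
    (∀ {j} → j ∈ p → ∃ λ k → k ∈ q × k ∉ p × k < j) → ∣ p ∣ + ∣ p ∣ ≤ ∣ q ∣
  preceded⇒∣p∣+∣p∣≤∣q∣ {p = []} {[]} _ _ _ = z≤n
  preceded⇒∣p∣+∣p∣≤∣q∣ {p = inside ∷ p} {_ ∷ q} _ _ pre with () ← proj₂ (proj₂ (proj₂ (pre here)))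
  -- The awaited element of `q` outside `p` is found; counting it absorbs the `suc` of the weaker
  -- bound.
  preceded⇒∣p∣+∣p∣≤∣q∣ {p = outside ∷ p} {inside ∷ q} p⊆q sep _ =
    interleaved⇒∣p∣+∣p∣≤1+∣q∣ (drop-∷-⊆ p⊆q) (Interleaved-tail sep)
  preceded⇒∣p∣+∣p∣≤∣q∣ {p = outside ∷ p} {outside ∷ q} p⊆q sep pre =
    preceded⇒∣p∣+∣p∣≤∣q∣ (drop-∷-⊆ p⊆q) (Interleaved-tail sep) preceded
    where
    preceded : ∀ {j} → j ∈ p → ∃ λ k → k ∈ q × k ∉ p × k < j
    preceded j∈p with pre (there j∈p)
    ... | suc k , k∈q , k∉p , s≤s k<j = k , drop-there k∈q , k∉p ∘ there , k<j

-- Halving, logarithms and degrees.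

m+m≤1+n⇒m≤⌈n/2⌉ : ∀ {m n} → m + m ≤ suc n → m ≤ ⌈ n /2⌉
-- By definition `⌈ n /2⌉` is `⌊ suc n /2⌋`.
m+m≤1+n⇒m≤⌈n/2⌉ {m} {n} le = subst (_≤ ⌈ n /2⌉) (≡.sym (ℕ.n≡⌊n+n/2⌋ m)) (ℕ.⌊n/2⌋-mono le)

⌈log₂n⌉≡0⇒n≤1 : ∀ {n} → ⌈log₂ n ⌉ ≡ 0 → n ≤ 1
⌈log₂n⌉≡0⇒n≤1 {zero}  _ = z≤n
⌈log₂n⌉≡0⇒n≤1 {suc zero} _ = s≤s z≤n
⌈log₂n⌉≡0⇒n≤1 {suc (suc n)} ()

lookup≤foldr-⊔ : ∀ (xs : Vec ℕ n) i → lookup xs i ≤ foldr (λ _ → ℕ) _⊔_ 0 xs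
lookup≤foldr-⊔ (x ∷ xs) zero    = ℕ.m≤m⊔n x _
lookup≤foldr-⊔ (x ∷ xs) (suc i) = ℕ.≤-trans (lookup≤foldr-⊔ xs i) (ℕ.m≤n⊔m x _)

degree≤maxDegree : ∀ (G : Graph n) u → degree G u ≤ maxDegree G
degree≤maxDegree G u =
  subst (_≤ maxDegree G) (trans (lookup-map u (degree G) (allFin _)) (cong (degree G) (lookup-allFin u)))
        (lookup≤foldr-⊔ (map (degree G) (allFin _)) u)

-- Linear order on subsets and lexicographic pairs.

bit : Bool → Fin 2
bit false = zero
bit true  = suc zero

bit-injective : ∀ {a b} → bit a ≡ bit b → a ≡ b
bit-injective {false} {false} _ = refl
bit-injective {true}  {true}  _ = refl

-- Sorting vertices by signature needs a linear order on subsets; reading a subset as a binary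
-- numeral supplies one.
encode : Subset n → Fin (2 ^ n)
encode []      = zero
encode (b ∷ p) = combine (bit b) (encode p)

encode-injective : ∀ {p q : Subset n} → encode p ≡ encode q → p ≡ q
encode-injective {p = []}    {[]}    _  = refl
encode-injective {p = a ∷ p} {b ∷ q} eq with Fin.combine-injective (bit a) (encode p) (bit b) (encode q) eq
... | a≡b , p≡q = cong₂ _∷_ (bit-injective a≡b) (encode-injective p≡q)

combine-cancelˡ-< : ∀ {m} {i j : Fin m} {k l : Fin n} → i ≡ j → combine i k < combine j l → k < l
combine-cancelˡ-< {n} {i = i} {k = k} {l} refl lt rewrite Fin.toℕ-combine i k | Fin.toℕ-combine i l =
  ℕ.+-cancelˡ-< (n * toℕ i) _ _ lt

combine-monoʳ-< : ∀ {m} {i j : Fin m} {k l : Fin n} → i ≡ j → k < l → combine i k < combine j l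
combine-monoʳ-< {n} {i = i} {k = k} {l} refl lt rewrite Fin.toℕ-combine i k | Fin.toℕ-combine i l =
  ℕ.+-monoʳ-< (n * toℕ i) lt

-- `combine` orders pairs lexicographically, so a different first coordinate would put the middle
-- pair before or after both of the others.
combine-convexˡ : ∀ {m} {h i j : Fin m} {k l o : Fin n} → h ≡ j →
  combine h k < combine i l → combine i l < combine j o → i ≡ h
combine-convexˡ {h = h} {i} {k = k} {l} {o} refl lo hi with Fin.<-cmp i h
... | tri< i<h _ _ = contradiction lo (Fin.<-asym (Fin.combine-monoˡ-< l k i<h))
... | tri≈ _ i≡h _ = i≡h
... | tri> _ _ h<i = contradiction hi (Fin.<-asym (Fin.combine-monoˡ-< o l h<i))

-- Existence of minimum locating-dominating sets.

IsLocDom? : ∀ (N : Fin n → Fin n → Bool) S → Dec (IsLocDom N S)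
IsLocDom? N S =
  (Fin.all? λ u → ¬? (u ∈? S) →-dec Fin.any? λ v → (v ∈? S) ×-dec (N u v Bool.≟ true))
  ×-dec
  (Fin.all? λ u → Fin.all? λ w → ¬? (u ∈? S) →-dec (¬? (w ∈? S) →-dec (¬? (u ≟ w) →-dec
     ¬? (Fin.all? λ v → (v ∈? S) →-dec (N u v Bool.≟ N w v)))))

⊤-IsLocDom : ∀ (N : Fin n → Fin n → Bool) → IsLocDom N ⊤
⊤-IsLocDom N = (λ u u∉⊤ → contradiction ∈⊤ u∉⊤) , (λ u w u∉⊤ → contradiction ∈⊤ u∉⊤)

-- Descent from the whole vertex set, which qualifies vacuously, to strictly smaller sets as long as
-- the decidable search finds one.
minimumLD : ∀ (N : Fin n → Fin n → Bool) → ∃ λ S → IsLocDom N S × (∀ T → IsLocDom N T → ∣ S ∣ ≤ ∣ T ∣)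
minimumLD {n} N = descend ⊤ (⊤-IsLocDom N) (<-wellFounded _)
  where
  descend : ∀ S → IsLocDom N S → Acc ℕ._<_ ∣ S ∣ →
            ∃ λ S → IsLocDom N S × (∀ T → IsLocDom N T → ∣ S ∣ ≤ ∣ T ∣)
  descend S ld (acc rec) with anySubset? (λ T → IsLocDom? N T ×-dec (∣ T ∣ ℕ.<? ∣ S ∣))
  ... | yes (T , ldT , T<S) = descend T ldT (rec T<S)
  ... | no  none            = S , ld , λ T ldT → ℕ.≮⇒≥ λ T<S → none (T , ldT , T<S)

module _ (G : Graph n) where

  -- Orientation along an injective key.

  orientBy : ∀ {k} (key : Fin n → Fin k) → (∀ {u v} → key u ≡ key v → u ≡ v) → Orientation G
  orientBy key inj .arc u v = adj G u v ∧ does (key u <? key v)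
  orientBy key inj .arc⇒adj u v a = Bool.∧-conicalˡ _ _ a
  orientBy key inj .adj⇒one u v uv with Fin.<-cmp (key u) (key v)
  ... | tri< u<v _ v≮u = inj₁
    (cong₂ _∧_ uv (dec-true (_ <? _) u<v)
    , trans (cong (adj G v u ∧_) (dec-false (_ <? _) v≮u)) (Bool.∧-zeroʳ _))
  ... | tri> u≮v _ v<u = inj₂
    (trans (cong (adj G u v ∧_) (dec-false (_ <? _) u≮v)) (Bool.∧-zeroʳ _)
    , cong₂ _∧_ (trans (Graph.sym G v u) uv) (dec-true (_ <? _) v<u))
  -- Equal keys would make the edge a loop.
  ... | tri≈ _ u≡v _ with refl ← inj u≡v with () ← trans (≡.sym uv) (irrefl G u)

  -- Traces, their classes and the sorting key.

  Agree : Subset n → Fin n → Fin n → Set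
  Agree S u v = ∀ w → w ∈ S → adj G u w ≡ adj G v w

  -- The leading bit keeps the vertices of S out of the classes of the others.
  opaque
    signature : Subset n → Fin n → Subset (suc n)
    signature S u = lookup S u ∷ tabulate (λ w → lookup S w ∧ adj G u w)

    signature≡⇒∉ : ∀ {S u v} → u ∉ S → signature S v ≡ signature S u → v ∉ S
    signature≡⇒∉ {S} {u} {v} u∉S eq v∈S =
      u∉S (lookup⇒[]= u S (trans (≡.sym (proj₁ (∷-injective eq))) ([]=⇒lookup v∈S)))

    signature≡⇒Agree : ∀ {S u v} → signature S v ≡ signature S u → Agree S v u
    signature≡⇒Agree {S} {u} {v} eq w w∈S = begin
      adj G v w                                          ≡⟨ lookup-trace v ⟨
      lookup (tabulate (λ x → lookup S x ∧ adj G v x)) w ≡⟨ cong (λ p → lookup p w) (proj₂ (∷-injective eq)) ⟩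
      lookup (tabulate (λ x → lookup S x ∧ adj G u x)) w ≡⟨ lookup-trace u ⟩
      adj G u w                                          ∎
      where
      open ≡-Reasoning
      lookup-trace : ∀ x → lookup (tabulate (λ y → lookup S y ∧ adj G x y)) w ≡ adj G x w
      lookup-trace x = trans (lookup∘tabulate _ w) (cong (_∧ adj G x w) ([]=⇒lookup w∈S))

    Agree⇒signature≡ : ∀ {S u v} → u ∉ S → v ∉ S → Agree S v u → signature S v ≡ signature S u
    Agree⇒signature≡ {S} {u} {v} u∉S v∉S agree =
      cong₂ _∷_ (trans (∉⇒lookup≡false v∉S) (≡.sym (∉⇒lookup≡false u∉S))) (tabulate-cong pointwise)
      where
      pointwise : ∀ w → lookup S w ∧ adj G v w ≡ lookup S w ∧ adj G u w
      pointwise w with w ∈? S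
      ... | yes w∈S = cong (lookup S w ∧_) (agree w w∈S)
      ... | no  w∉S rewrite ∉⇒lookup≡false w∉S = refl

  opaque
    class : Subset n → Fin n → Subset n
    class S u = tabulate λ v → does (≡-dec Bool._≟_ (signature S v) (signature S u))

    ∈-class⁺ : ∀ {S u v} → signature S v ≡ signature S u → v ∈ class S u
    ∈-class⁺ eq = ∈-tabulate⁺ (dec-true (≡-dec Bool._≟_ _ _) eq)

    ∈-class⁻ : ∀ {S u v} → v ∈ class S u → signature S v ≡ signature S u
    ∈-class⁻ {S} {u} {v} v∈ =
      does≡true⇒ (≡-dec Bool._≟_ (signature S v) (signature S u)) (∈-tabulate⁻ v∈)

  -- The second component only breaks ties, so every class is an interval of
  -- keys on which keys are ordered like vertices.
  key : Subset n → Fin n → Fin (2 ^ suc n * n)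
  key S u = combine (encode (signature S u)) u

  key-injective : ∀ S {u v} → key S u ≡ key S v → u ≡ v
  key-injective S {u} {v} =
    Fin.combine-injectiveʳ (encode (signature S u)) u (encode (signature S v)) v

  key-mono-< : ∀ {S u v} → signature S u ≡ signature S v → u < v → key S u < key S v
  key-mono-< u≡v = combine-monoʳ-< (cong encode u≡v)

  key-between : ∀ {S u v x} → signature S u ≡ signature S v → key S u < key S x → key S x < key S v →
    signature S x ≡ signature S u × u < x × x < v
  key-between {S} {u} {v} {x} u≡v u<x x<v =
    encode-injective x≡u , combine-cancelˡ-< (≡.sym x≡u) u<x ,
    combine-cancelˡ-< (trans x≡u (cong encode u≡v)) x<v
    where
    x≡u : encode (signature S x) ≡ encode (signature S u)
    x≡u = combine-convexˡ (cong encode u≡v) u<x x<v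

  -- Separation in the layered orientation.

  layered : Subset n → Orientation G
  layered S = orientBy (key S) (key-injective S)

  -- An arc enters `u` from `x` exactly when they are adjacent and `x` has the smaller key.
  -- Adjacency to `S′` is the same for `u` and `v`, so without a key of `S′` between theirs they
  -- would have equal in-neighbourhoods in `S′`.
  separator : ∀ {S S′ u v} → IsLocDom (inNbhd (layered S)) S′ → u ∉ S′ → v ∉ S′ →
    signature S u ≡ signature S v → Agree S′ u v → u < v →
    ∃ λ x → x ∈ S′ × signature S x ≡ signature S u × u < x × x < v
  separator {S} {S′} {u} {v} (_ , separates) u∉S′ v∉S′ u≡v agree u<v
    with Fin.any? (λ x → (x ∈? S′) ×-dec (key S u <? key S x) ×-dec (key S x <? key S v))
  ... | yes (x , x∈S′ , u<x , x<v) = x , x∈S′ , key-between u≡v u<x x<v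
  ... | no  none = contradiction sameArcs (separates u v u∉S′ v∉S′ (Fin.<⇒≢ u<v))
    where
    sameOrder : ∀ x → x ∈ S′ → does (key S x <? key S u) ≡ does (key S x <? key S v)
    sameOrder x x∈S′ with Fin.<-cmp (key S x) (key S u)
    ... | tri< x<u _ _ =
      trans (dec-true (_ <? _) x<u) (≡.sym (dec-true (_ <? _) (Fin.<-trans x<u (key-mono-< u≡v u<v))))
    ... | tri≈ _ x≡u _ = contradiction (subst (_∈ S′) (key-injective S x≡u) x∈S′) u∉S′
    ... | tri> x≮u _ u<x =
      trans (dec-false (_ <? _) x≮u) (≡.sym (dec-false (_ <? _) λ x<v → none (x , x∈S′ , u<x , x<v)))

    sameArcs : ∀ x → x ∈ S′ → inNbhd (layered S) u x ≡ inNbhd (layered S) v x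
    sameArcs x x∈S′ =
      cong₂ _∧_ (trans (Graph.sym G x u) (trans (agree x x∈S′) (Graph.sym G v x))) (sameOrder x x∈S′)

  -- Refining and halving the classes.

  ClassesBoundedBy : ℕ → Subset n → Set
  ClassesBoundedBy m S = ∀ u → u ∉ S → ∣ class S u ∣ ≤ m

  Dominating : Subset n → Set
  Dominating S = ∀ u → u ∉ S → ∃ λ v → v ∈ S × adj G u v ≡ true

  Dominating-⊆ : ∀ {S R} → S ⊆ R → Dominating S → Dominating R
  Dominating-⊆ S⊆R dom u u∉R with dom u (u∉R ∘ S⊆R)
  ... | v , v∈S , uv = v , S⊆R v∈S , uv

  -- Agreement on the union restricts to `S`. Since `u` is outside the union, so is its whole class,
  -- and hence the leading bits of the signatures for `S` coincide too.
  class-∪-⊆ : ∀ {S S′ u} → u ∉ S ∪ S′ → class (S ∪ S′) u ⊆ class S u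
  class-∪-⊆ {S} {S′} u∉R v∈T =
    ∈-class⁺ (Agree⇒signature≡ (u∉R ∘ p⊆p∪q S′) (signature≡⇒∉ u∉R eq ∘ p⊆p∪q S′)
      (λ w w∈S → signature≡⇒Agree eq w (p⊆p∪q S′ w∈S)))
    where eq = ∈-class⁻ v∈T

  -- The new class is interleaved in the old one: a separator of two of its members has their trace
  -- on `S`, so it lies in the old class, but it belongs to `S′`, so it is not in the new one.
  halveClasses : ∀ {m S S′} → IsLocDom (inNbhd (layered S)) S′ →
    ClassesBoundedBy m S → ClassesBoundedBy ⌈ m /2⌉ (S ∪ S′)
  halveClasses {m} {S} {S′} ld bounded u u∉R =
    m+m≤1+n⇒m≤⌈n/2⌉ (ℕ.≤-trans (interleaved⇒∣p∣+∣p∣≤1+∣q∣ (class-∪-⊆ u∉R) alternating)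
                                (s≤s (bounded u (u∉R ∘ p⊆p∪q S′))))
    where
    alternating : Interleaved (class (S ∪ S′) u) (class S u)
    alternating {i} {j} i∈T j∈T i<j =
      let x , x∈S′ , x≡i , i<x , x<j =
            separator ld (i∉R ∘ q⊆p∪q S S′) (j∉R ∘ q⊆p∪q S S′) (trans iₛ (≡.sym jₛ)) agree i<j
      in x , ∈-class⁺ (trans x≡i iₛ)
           , (λ x∈T → signature≡⇒∉ u∉R (∈-class⁻ x∈T) (q⊆p∪q S S′ x∈S′)) , i<x , x<j
      where
      iᵣ = ∈-class⁻ i∈T
      jᵣ = ∈-class⁻ j∈T
      iₛ = ∈-class⁻ (class-∪-⊆ u∉R i∈T)
      jₛ = ∈-class⁻ (class-∪-⊆ u∉R j∈T)
      i∉R = signature≡⇒∉ u∉R iᵣ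
      j∉R = signature≡⇒∉ u∉R jᵣ
      agree : Agree S′ i j
      agree w w∈S′ = signature≡⇒Agree (trans iᵣ (≡.sym jᵣ)) w (q⊆p∪q S S′ w∈S′)

  singletonClasses⇒IsLocDom : ∀ {S} → Dominating S → ClassesBoundedBy 1 S → IsLocDom (nbhd G) S
  singletonClasses⇒IsLocDom dom bounded = dom , λ u w u∉S w∉S u≢w agree →
    ℕ.<⇒≱ (distinct∈⇒2≤∣p∣ (∈-class⁺ {u = u} refl)
                            (∈-class⁺ (≡.sym (Agree⇒signature≡ w∉S u∉S agree))) u≢w)
           (bounded u u∉S)

  LD⇒Dominating : ∀ (D : Orientation G) {S} → IsLocDom (inNbhd D) S → Dominating S
  LD⇒Dominating D (dom , _) u u∉S with dom u u∉S
  ... | v , v∈S , vu = v , v∈S , trans (Graph.sym G u v) (arc⇒adj D v u vu)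

  -- A neighbour `x` of `u` in `S` belongs to the common trace, so the whole class lies in the
  -- neighbourhood of `x`.
  Dominating⇒classes≤maxDegree : ∀ {S} → Dominating S → ClassesBoundedBy (maxDegree G) S
  Dominating⇒classes≤maxDegree {S} dom u u∉S with dom u u∉S
  ... | x , x∈S , ux = ℕ.≤-trans (p⊆q⇒∣p∣≤∣q∣ class⊆N[x]) (degree≤maxDegree G x)
    where
    class⊆N[x] : class S u ⊆ tabulate (adj G x)
    class⊆N[x] {v} v∈ =
      ∈-tabulate⁺ (trans (Graph.sym G x v) (trans (signature≡⇒Agree (∈-class⁻ v∈) x x∈S) ux))

  -- Iterating the refinement.

  module _ {Γ : ℕ} (upper : ∀ (D : Orientation G) k → IsγLDᴰ D k → k ≤ Γ) where

    -- `upper` speaks of exact minimum values only, so it is applied to the size of a minimum set.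
    smallLD : ∀ D → ∃ λ S → IsLocDom (inNbhd D) S × ∣ S ∣ ≤ Γ
    smallLD D with minimumLD (inNbhd D)
    ... | S , ld , least = S , ld , upper D ∣ S ∣ ((S , ld , refl) , least)

    -- Induction on the number `k` of rounds left: a round adds at most `Γ` vertices and replaces
    -- `m` by `⌈ m /2⌉`, which lowers `⌈log₂ m ⌉` by one. At `k = 0` the classes have at most one
    -- element.
    refineClasses : ∀ k {m} S → ⌈log₂ m ⌉ ≡ k → Dominating S → ClassesBoundedBy m S →
      ∃ λ R → IsLocDom (nbhd G) R × ∣ R ∣ ≤ ∣ S ∣ + k * Γ
    refineClasses zero S log dom bounded =
      S , singletonClasses⇒IsLocDom dom (λ u u∉S → ℕ.≤-trans (bounded u u∉S) (⌈log₂n⌉≡0⇒n≤1 log)) ,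
      ℕ.m≤m+n _ _
    refineClasses (suc k) {m} S log dom bounded with smallLD (layered S)
    ... | S′ , ld′ , S′≤Γ
      with refineClasses k (S ∪ S′) (trans (⌈log₂⌈n/2⌉⌉≡⌈log₂n⌉∸1 m) (cong (ℕ._∸ 1) log))
             (Dominating-⊆ (p⊆p∪q S′) dom) (halveClasses ld′ bounded)
    ... | R , ld , R≤ = R , ld , (begin
      ∣ R ∣                     ≤⟨ R≤ ⟩
      ∣ S ∪ S′ ∣ + k * Γ        ≤⟨ ℕ.+-monoˡ-≤ (k * Γ) (∣p∪q∣≤∣p∣+∣q∣ S S′) ⟩
      ∣ S ∣ + ∣ S′ ∣ + k * Γ    ≡⟨ ℕ.+-assoc ∣ S ∣ ∣ S′ ∣ (k * Γ) ⟩
      ∣ S ∣ + (∣ S′ ∣ + k * Γ)  ≤⟨ ℕ.+-monoʳ-≤ ∣ S ∣ (ℕ.+-monoˡ-≤ (k * Γ) S′≤Γ) ⟩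
      ∣ S ∣ + suc k * Γ         ∎)
      where open ℕ.≤-Reasoning

theorem36 : ∀ {n} (G : Graph n) (γ Γ : ℕ) →
    IsγLD G γ → IsUpperDirLD G Γ →
    γ ≤ (⌈log₂ maxDegree G ⌉ + 1) * Γ
-- The minimum set of the given orientation `D` starts the refinement; its size accounts for the
-- `+ 1` in the factor.
theorem36 G γ Γ (_ , γ≤) ((D , _) , upper) with smallLD G upper D
... | S , ldS , S≤Γ
  with refineClasses G upper ⌈log₂ maxDegree G ⌉ S refl (LD⇒Dominating G D ldS)
         (Dominating⇒classes≤maxDegree G (LD⇒Dominating G D ldS))
... | R , ld , R≤ = begin
  γ                              ≤⟨ γ≤ R ld ⟩
  ∣ R ∣                          ≤⟨ R≤ ⟩
  ∣ S ∣ + l * Γ                  ≤⟨ ℕ.+-monoˡ-≤ (l * Γ) S≤Γ ⟩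
  suc l * Γ                      ≡⟨ cong (_* Γ) (ℕ.+-comm 1 l) ⟩
  (l + 1) * Γ                    ∎
  where
  open ℕ.≤-Reasoning
  l = ⌈log₂ maxDegree G ⌉
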